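{- Work in the constructive set theory $\mathbf{CZF}$ (intuitionistic logic). Let $\mathbb{A}$ be an infinite set with decidable equality, and consider the nominal set $(\mathbb{A}+1)^{\mathbb{N}}$ (the exponential in the category of nominal sets of the nominal set $\mathbb{A}+1$ by the nominal set $\mathbb{N}$). If $(\mathbb{A}+1)^{\mathbb{N}}$ admits a support function, then $\mathbf{WLPO}$ holds.
   Context: Terminology: a set $X$ has decidable equality if for all $x,y\in X$, $x=y$ or $x\neq y$. A set is finite if it is in bijection with $n=\{0,\dots,n-1\}$ for some $n\in\mathbb{N}$. A set $X$ is infinite if for every finite $Y\subseteq X$ there is $x\in X$ with $x\notin Y$. $\mathbf{WLPO}$ (weak limited principle of omniscience) is the statement: for every $\alpha\colon\mathbb{N}\to 2$, either $(\forall n\in\mathbb{N})\,\alpha(n)=0$ or $\neg(\forall n\in\mathbb{N})\,\alpha(n)=0$. $\operatorname{Perm}(\mathbb{A})$ is the group of finite permutations of $\mathbb{A}$ (permutations fixing all but finitely many elements). A $\operatorname{Perm}(\mathbb{A})$-set is a set with an action $\cdot$ of this group. For $x$ in a $\operatorname{Perm}(\mathbb{A})$-set, a set $A\subseteq\mathbb{A}$ is a support of $x$ if every $\pi\in\operatorname{Perm}(\mathbb{A})$ with $\pi(a)=a$ for all $a\in A$ satisfies $\pi\cdot x=x$; $x$ is equivariant if $\emptyset$ is a support. A nominal set is a $\operatorname{Perm}(\mathbb{A})$-set in which every element has some finite support. A support function on a nominal set $X$ is a function $S\colon X\to\mathcal{P}_{\mathrm{fin}}(\mathbb{A})$ (finite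 subsets of $\mathbb{A}$) such that $S(x)$ is a support of $x$ for every $x\in X$. Here $\mathbb{A}$ is a nominal set with $\pi\cdot a=\pi(a)$; $1=\{\ast\}$ and $\mathbb{N}$ carry the trivial action; $\mathbb{A}+1$ is the disjoint union with componentwise action; and $(\mathbb{A}+1)^{\mathbb{N}}$ is the set of those functions $f\colon\mathbb{N}\to\mathbb{A}+1$ that have a finite support with respect to the conjugation action $(\pi\cdot f)(n)=\pi\cdot f(\pi^{ -1}\cdot n)$. -}

-- Sets are rendered as setoids: functions between them respect the given
-- equalities, subsets respect the equality of the ambient set, and the elements
-- of a subset are compared in the ambient set.

module Defs where

open import Level using (Level; _⊔_; 0ℓ) renaming (suc to lsuc)
open import Algebra.Bundles using (Group)
open import Data.Empty using (⊥-elim)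
open import Data.Fin.Base using (Fin; zero; suc)
open import Data.List.Base using (List; []; _∷_; _++_; [_]; length; lookup; filter; deduplicate; tabulate)
open import Data.List.Relation.Unary.Any as Any using (here)
open import Data.List.Relation.Unary.Any.Properties using (lookup-index)
open import Data.List.Relation.Unary.All as All using ()
open import Data.List.Relation.Unary.AllPairs using (_∷_)
open import Data.List.Membership.Propositional.Properties using (∈-lookup)
open import Data.Nat.Base using (ℕ)
open import Data.Product.Base using (Σ; ∃; _,_; proj₁; proj₂)
open import Data.Sum.Base using (_⊎_; inj₁; inj₂) renaming (map to ⊎-map)
open import Data.Sum.Relation.Binary.Pointwise using (⊎-setoid; inj₁; inj₂)
open import Data.Unit.Base using (⊤)
open import Function.Base using (_∘_)
open import Function.Bundles using (Func; Inverse; _⟨$⟩_)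
import Algebra.Properties.Group as GroupProperties
import Function.Construct.Composition as Composition
import Function.Construct.Identity as Identity
import Function.Construct.Symmetry as Symmetry
import Function.Relation.Binary.Setoid.Equality as FuncEquality
open import Relation.Binary.Bundles using (Setoid; DecSetoid)
open import Relation.Binary.Definitions using (_Respects_)
import Relation.Binary.Construct.On as On
open import Relation.Binary.PropositionalEquality as ≡ using (_≡_)
import Relation.Binary.Reasoning.Setoid as SetoidReasoning
open import Relation.Nullary using (¬_; yes; no)
open import Relation.Nullary.Decidable using (¬?)
open import Relation.Unary using (Pred; Decidable; _≐_)
import Data.List.Membership.Setoid as Membership
import Data.List.Membership.Setoid.Properties as Membershipₚ
import Data.List.Relation.Unary.Unique.Setoid as Uniqueness
import Data.List.Relation.Unary.Unique.DecSetoid.Properties as Uniquenessₚ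

private
  variable
    a c ℓ p x e y f : Level

WLPO : Set
WLPO = (α : ℕ → Fin 2) → (∀ n → α n ≡ zero) ⊎ ¬ (∀ n → α n ≡ zero)

subsetoid : (S : Setoid a ℓ) → Pred (Setoid.Carrier S) p → Setoid (a ⊔ p) ℓ
subsetoid S P = On.setoid S (proj₁ {B = P})

Finite : Setoid a ℓ → Set (a ⊔ ℓ)
Finite S = ∃ λ n → Inverse (≡.setoid (Fin n)) S

record FinSubset (S : Setoid a ℓ) : Set (lsuc (a ⊔ ℓ)) where
  open Setoid S using (Carrier; _≈_)
  field
    member   : Pred Carrier (a ⊔ ℓ)
    respects : member Respects _≈_
    finite   : Finite (subsetoid S member)

infix 4 _∈_ _∉_

_∈_ : {S : Setoid a ℓ} → Setoid.Carrier S → FinSubset S → Set (a ⊔ ℓ)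
s ∈ Y = FinSubset.member Y s

_∉_ : {S : Setoid a ℓ} → Setoid.Carrier S → FinSubset S → Set (a ⊔ ℓ)
s ∉ Y = ¬ (s ∈ Y)

𝒫fin : Setoid a ℓ → Setoid (lsuc (a ⊔ ℓ)) (a ⊔ ℓ)
𝒫fin S = record
  { Carrier       = FinSubset S
  ; _≈_           = λ Y Z → FinSubset.member Y ≐ FinSubset.member Z
  ; isEquivalence = record
    { refl  = (λ m → m) , (λ m → m)
    ; sym   = λ (i , j) → j , i
    ; trans = λ (i , j) (k , l) → k ∘ i , j ∘ l
    }
  }

Infinite : Setoid a ℓ → Set (lsuc (a ⊔ ℓ))
Infinite S = (Y : FinSubset S) → ∃ λ s → s ∉ Y

module _ (S : Setoid a ℓ) where
  open Setoid S using (Carrier; _≈_)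

  elements : {P : Pred Carrier p} → Finite (subsetoid S P) → List Carrier
  elements (n , i) = tabulate (proj₁ ∘ Inverse.to i)

  ∈-elements : {P : Pred Carrier p} (fin : Finite (subsetoid S P)) →
               ∀ {s} → P s → Membership._∈_ S s (elements fin)
  ∈-elements (n , i) {s} Ps =
    Membershipₚ.∈-resp-≈ S (Inverse.inverseˡ i {x = s , Ps} ≡.refl)
      (Membershipₚ.∈-tabulate⁺ S (Inverse.from i (s , Ps)))

  open Uniqueness S using (Unique)

  lookup-injective : ∀ {xs} → Unique xs → ∀ {i j} →
                     lookup xs i ≈ lookup xs j → i ≡ j
  lookup-injective {_ ∷ _}  (_  ∷ _) {zero}  {zero}  _  = ≡.refl
  lookup-injective {_ ∷ xs} (x≉ ∷ _) {zero}  {suc j} eq =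
    ⊥-elim (All.lookup x≉ (∈-lookup j) eq)
  lookup-injective {_ ∷ xs} (x≉ ∷ _) {suc i} {zero}  eq =
    ⊥-elim (All.lookup x≉ (∈-lookup i) (Setoid.sym S eq))
  lookup-injective {_ ∷ _}  (_  ∷ u) {suc i} {suc j} eq =
    ≡.cong suc (lookup-injective u eq)

module _ (D : DecSetoid a ℓ) where
  open DecSetoid D using (Carrier; _≈_; _≟_; setoid)
  private module D = DecSetoid D

  finite-within : {P : Pred Carrier p} → P Respects _≈_ → Decidable P →
                  (xs : List Carrier) →
                  (∀ {s} → P s → Membership._∈_ setoid s xs) →
                  Finite (subsetoid setoid P)
  finite-within {P = P} resp P? xs P⊆xs = length ys , record
    { to        = λ i → lookup ys i , Py i
    ; from      = λ (s , Ps) → Any.index (s∈ys Ps)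
    ; to-cong   = λ { ≡.refl → D.refl }
    ; from-cong = λ {(s , Ps)} {(t , Pt)} s≈t → lookup-injective setoid unique
        (D.trans (D.sym (lookup-index (s∈ys Ps)))
          (D.trans s≈t (lookup-index (s∈ys Pt))))
    ; inverse   =
        (λ { {s , Ps} ≡.refl → D.sym (lookup-index (s∈ys Ps)) })
      , (λ {i} {(s , Ps)} s≈yᵢ → lookup-injective setoid unique
          (D.trans (D.sym (lookup-index (s∈ys Ps))) s≈yᵢ))
    }
    where
    ys : List Carrier
    ys = deduplicate _≟_ (filter P? xs)

    unique : Uniqueness.Unique setoid ys
    unique = Uniquenessₚ.deduplicate-! D (filter P? xs)

    s∈ys : ∀ {s} → P s → Membership._∈_ setoid s ys
    s∈ys Ps = Membershipₚ.∈-deduplicate⁺ setoid _≟_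
      (λ z≈y x≈y → D.trans x≈y (D.sym z≈y))
      (Membershipₚ.∈-filter⁺ setoid P? resp (P⊆xs Ps) Ps)

    Py : ∀ i → P (lookup ys i)
    Py i = proj₂ (Membershipₚ.∈-filter⁻ setoid P? resp {xs = xs}
      (Membershipₚ.∈-deduplicate⁻ setoid _≟_ (filter P? xs)
        (Membershipₚ.∈-lookup setoid ys i)))

  fromList : List Carrier → FinSubset setoid
  fromList xs = record
    { member   = λ s → Membership._∈_ setoid s xs
    ; respects = Membershipₚ.∈-resp-≈ setoid
    ; finite   = finite-within (Membershipₚ.∈-resp-≈ setoid)
        (λ s → Any.any? (s ≟_) xs) xs (λ m → m)
    }

record GSet (G : Group a ℓ) (x e : Level) : Set (a ⊔ ℓ ⊔ lsuc (x ⊔ e)) where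
  open Group G using () renaming (Carrier to |G|; _≈_ to _≈ᴳ_; _∙_ to _∙ᴳ_; ε to εᴳ)
  infixr 7 _·_
  field
    setoid : Setoid x e
  open Setoid setoid public
  field
    _·_        : |G| → Carrier → Carrier
    ·-cong     : ∀ {g h u v} → g ≈ᴳ h → u ≈ v → g · u ≈ h · v
    ·-identity : ∀ u → εᴳ · u ≈ u
    ·-assoc    : ∀ g h u → (g ∙ᴳ h) · u ≈ g · (h · u)

module _ {G : Group a ℓ} where
  private
    module G = Group G
    module Gₚ = GroupProperties G

  trivial : Setoid x e → GSet G x e
  trivial S = record
    { setoid     = S
    ; _·_        = λ _ u → u
    ; ·-cong     = λ _ u≈v → u≈v
    ; ·-identity = λ _ → Setoid.refl S
    ; ·-assoc    = λ _ _ _ → Setoid.refl S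
    }

  infixr 5 _⊎ᴳ_
  _⊎ᴳ_ : GSet G x e → GSet G y f → GSet G (x ⊔ y) (x ⊔ y ⊔ e ⊔ f)
  X ⊎ᴳ Y = record
    { setoid     = ⊎-setoid X.setoid Y.setoid
    ; _·_        = λ g → ⊎-map (g X.·_) (g Y.·_)
    ; ·-cong     = λ { g≈h (inj₁ u≈v) → inj₁ (X.·-cong g≈h u≈v)
                     ; g≈h (inj₂ u≈v) → inj₂ (Y.·-cong g≈h u≈v) }
    ; ·-identity = λ { (inj₁ u) → inj₁ (X.·-identity u)
                     ; (inj₂ v) → inj₂ (Y.·-identity v) }
    ; ·-assoc    = λ { g h (inj₁ u) → inj₁ (X.·-assoc g h u)
                     ; g h (inj₂ v) → inj₂ (Y.·-assoc g h v) }
    }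
    where module X = GSet X
          module Y = GSet Y

  -- The underlying functions are arbitrary, not just the equivariant ones.
  _⇒ᴳ_ : GSet G x e → GSet G y f → GSet G (x ⊔ e ⊔ y ⊔ f) (x ⊔ f)
  X ⇒ᴳ Y = record
    { setoid     = FuncEquality.setoid X.setoid Y.setoid
    ; _·_        = λ g φ → record
        { to   = λ u → g Y.· (φ ⟨$⟩ (g G.⁻¹ X.· u))
        ; cong = λ u≈v → Y.·-cong G.refl (Func.cong φ (X.·-cong G.refl u≈v))
        }
    ; ·-cong     = λ {g} {h} {φ} {ψ} g≈h φ≈ψ u → Y.·-cong g≈h
        (Y.trans (Func.cong φ (X.·-cong (G.⁻¹-cong g≈h) X.refl)) (φ≈ψ _))
    ; ·-identity = λ φ u → Y.trans (Y.·-identity _)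
        (Func.cong φ (X.trans (X.·-cong Gₚ.ε⁻¹≈ε X.refl) (X.·-identity u)))
    ; ·-assoc    = λ g h φ u → Y.trans (Y.·-assoc g h _)
        (Y.·-cong G.refl (Y.·-cong G.refl (Func.cong φ
          (X.trans (X.·-cong (Gₚ.⁻¹-anti-homo-∙ g h) X.refl) (X.·-assoc _ _ u)))))
    }
    where module X = GSet X
          module Y = GSet Y

module Nominal (𝔸 : DecSetoid c ℓ) where
  open DecSetoid 𝔸 using (_≈_; _≉_; _≟_) renaming (Carrier to Atom; setoid to 𝔸ₛ)
  private module 𝔸 = DecSetoid 𝔸

  Moved : Inverse 𝔸ₛ 𝔸ₛ → Pred Atom ℓ
  Moved π a = Inverse.to π a ≉ a

  record FinPerm : Set (c ⊔ ℓ) where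
    field
      perm         : Inverse 𝔸ₛ 𝔸ₛ
      moved-finite : Finite (subsetoid 𝔸ₛ (Moved perm))
    open Inverse perm public using (to; from; to-cong; from-cong)

    to∘from : ∀ a → to (from a) ≈ a
    to∘from a = Inverse.strictlyInverseˡ perm a

    from∘to : ∀ a → from (to a) ≈ a
    from∘to a = Inverse.strictlyInverseʳ perm a

  mkFinPerm : (π : Inverse 𝔸ₛ 𝔸ₛ) (xs : List Atom) →
              (∀ {a} → Moved π a → Membership._∈_ 𝔸ₛ a xs) → FinPerm
  mkFinPerm π xs moved⊆xs = record
    { perm         = π
    ; moved-finite = finite-within 𝔸
        (λ a≈b πa≉a πb≈b → πa≉a
          (𝔸.trans (Inverse.to-cong π a≈b) (𝔸.trans πb≈b (𝔸.sym a≈b))))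
        (λ a → ¬? (Inverse.to π a ≟ a)) xs moved⊆xs
    }

  idᵖ : FinPerm
  idᵖ = mkFinPerm (Identity.inverse 𝔸ₛ) [] (λ a≉a → ⊥-elim (a≉a 𝔸.refl))

  _∘ᵖ_ : FinPerm → FinPerm → FinPerm
  π ∘ᵖ σ = mkFinPerm (Composition.inverse σ.perm π.perm)
    (elements 𝔸ₛ π.moved-finite ++ elements 𝔸ₛ σ.moved-finite) moved
    where
    module π = FinPerm π
    module σ = FinPerm σ
    moved : ∀ {a} → π.to (σ.to a) ≉ a → Membership._∈_ 𝔸ₛ a
              (elements 𝔸ₛ π.moved-finite ++ elements 𝔸ₛ σ.moved-finite)
    moved {a} πσa≉a with σ.to a ≟ a
    ... | yes σa≈a = Membershipₚ.∈-++⁺ˡ 𝔸ₛ (∈-elements 𝔸ₛ π.moved-finite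
                       (λ πa≈a → πσa≉a (𝔸.trans (π.to-cong σa≈a) πa≈a)))
    ... | no  σa≉a = Membershipₚ.∈-++⁺ʳ 𝔸ₛ (elements 𝔸ₛ π.moved-finite)
                       (∈-elements 𝔸ₛ σ.moved-finite σa≉a)

  _⁻¹ᵖ : FinPerm → FinPerm
  π ⁻¹ᵖ = mkFinPerm (Symmetry.inverse π.perm) (elements 𝔸ₛ π.moved-finite)
    (λ {a} π⁻¹a≉a → ∈-elements 𝔸ₛ π.moved-finite
      (λ πa≈a → π⁻¹a≉a (𝔸.trans (π.from-cong (𝔸.sym πa≈a)) (π.from∘to a))))
    where module π = FinPerm π

  Perm : Group (c ⊔ ℓ) (c ⊔ ℓ)
  Perm = record
    { Carrier = FinPerm
    ; _≈_     = λ π σ → ∀ a → FinPerm.to π a ≈ FinPerm.to σ a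
    ; _∙_     = _∘ᵖ_
    ; ε       = idᵖ
    ; _⁻¹     = _⁻¹ᵖ
    ; isGroup = record
      { isMonoid = record
        { isSemigroup = record
          { isMagma = record
            { isEquivalence = record
              { refl  = λ _ → 𝔸.refl
              ; sym   = λ π≈σ a → 𝔸.sym (π≈σ a)
              ; trans = λ π≈σ σ≈τ a → 𝔸.trans (π≈σ a) (σ≈τ a)
              }
            ; ∙-cong = λ {π} {π′} {σ} {σ′} π≈π′ σ≈σ′ a →
                𝔸.trans (FinPerm.to-cong π (σ≈σ′ a)) (π≈π′ (FinPerm.to σ′ a))
            }
          ; assoc = λ _ _ _ _ → 𝔸.refl
          }
        ; identity = (λ _ _ → 𝔸.refl) , (λ _ _ → 𝔸.refl)
        }
      ; inverse = FinPerm.from∘to , FinPerm.to∘from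
      ; ⁻¹-cong = λ {π} {σ} π≈σ a → 𝔸.trans
          (FinPerm.from-cong π
            (𝔸.trans (𝔸.sym (FinPerm.to∘from σ a)) (𝔸.sym (π≈σ (FinPerm.from σ a)))))
          (FinPerm.from∘to π (FinPerm.from σ a))
      }
    }

  PermSet : (x e : Level) → Set (c ⊔ ℓ ⊔ lsuc (x ⊔ e))
  PermSet = GSet Perm

  IsSupport : (X : PermSet x e) → Pred Atom p → GSet.Carrier X → Set (c ⊔ ℓ ⊔ e ⊔ p)
  IsSupport X A u =
    (π : FinPerm) → (∀ a → A a → FinPerm.to π a ≈ a) → GSet._≈_ X (GSet._·_ X π u) u

  FinitelySupported : (X : PermSet x e) → GSet.Carrier X → Set (lsuc (c ⊔ ℓ) ⊔ e)
  FinitelySupported X u = ∃ λ (A : FinSubset 𝔸ₛ) → IsSupport X (_∈ A) u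

  record NominalSet (x e : Level) : Set (lsuc (c ⊔ ℓ ⊔ x ⊔ e)) where
    field
      permSet            : PermSet x e
      finitely-supported : ∀ u → FinitelySupported permSet u
    open GSet permSet public

  -- Functions between sets are extensional, so S respects the equality of X and
  -- finite subsets are equal when they have the same elements.
  SupportFunction : NominalSet x e → Set (lsuc (c ⊔ ℓ) ⊔ x ⊔ e)
  SupportFunction X = Σ (Func X.setoid (𝒫fin 𝔸ₛ)) λ S →
    ∀ u → IsSupport X.permSet (_∈ (S ⟨$⟩ u)) u
    where module X = NominalSet X

  atoms : NominalSet c ℓ
  atoms = record
    { permSet = record
      { setoid     = 𝔸ₛ
      ; _·_        = FinPerm.to
      ; ·-cong     = λ {π} {σ} {a} {b} π≈σ a≈b → 𝔸.trans (FinPerm.to-cong π a≈b) (π≈σ b)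
      ; ·-identity = λ _ → 𝔸.refl
      ; ·-assoc    = λ _ _ _ → 𝔸.refl
      }
    ; finitely-supported = λ a → fromList 𝔸 [ a ] , λ π fix → fix a (here 𝔸.refl)
    }

  discrete : Setoid x e → NominalSet x e
  discrete S = record
    { permSet            = trivial S
    ; finitely-supported = λ _ → fromList 𝔸 [] , λ _ _ → Setoid.refl S
    }

  infixr 5 _⊎ᴺ_
  _⊎ᴺ_ : NominalSet x e → NominalSet y f → NominalSet (x ⊔ y) (x ⊔ y ⊔ e ⊔ f)
  X ⊎ᴺ Y = record
    { permSet            = X.permSet ⊎ᴳ Y.permSet
    ; finitely-supported = λ
      { (inj₁ u) → let A , supp = X.finitely-supported u in A , λ π fix → inj₁ (supp π fix)
      ; (inj₂ v) → let A , supp = Y.finitely-supported v in A , λ π fix → inj₂ (supp π fix)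
      }
    }
    where module X = NominalSet X
          module Y = NominalSet Y

  image : FinPerm → FinSubset 𝔸ₛ → FinSubset 𝔸ₛ
  image π A = record
    { member   = λ a → π.from a ∈ A
    ; respects = λ a≈b → A.respects (π.from-cong a≈b)
    ; finite   = proj₁ A.finite , Composition.inverse (proj₂ A.finite) (record
        { to        = λ (a , a∈A) → π.to a , A.respects (𝔸.sym (π.from∘to a)) a∈A
        ; from      = λ (b , b∈πA) → π.from b , b∈πA
        ; to-cong   = π.to-cong
        ; from-cong = π.from-cong
        ; inverse   = (λ eq → 𝔸.trans (π.to-cong eq) (π.to∘from _))
                    , (λ eq → 𝔸.trans (π.from-cong eq) (π.from∘to _))
        })
    }
    where module π = FinPerm π
          module A = FinSubset A

  image-supports : (X : PermSet x e) (π : FinPerm) (A : FinSubset 𝔸ₛ) {u : GSet.Carrier X} →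
                   IsSupport X (_∈ A) u →
                   IsSupport X (_∈ image π A) (GSet._·_ X π u)
  image-supports X π A {u} supp σ fix = begin
    σ · π · u                          ≈⟨ X.·-assoc σ π u ⟨
    (σ ∘ᵖ π) · u                       ≈⟨ X.·-cong (λ a → 𝔸.sym (π.to∘from _)) X.refl ⟩
    (π ∘ᵖ ((π ⁻¹ᵖ) ∘ᵖ (σ ∘ᵖ π))) · u   ≈⟨ X.·-assoc π _ u ⟩
    π · ((π ⁻¹ᵖ) ∘ᵖ (σ ∘ᵖ π)) · u      ≈⟨ X.·-cong {π} (λ _ → 𝔸.refl) (supp _ fix′) ⟩
    π · u                              ∎
    where
    module X = GSet X
    module π = FinPerm π
    open X using (_·_)
    open SetoidReasoning X.setoid
    fix′ : ∀ a → a ∈ A → π.from (FinPerm.to σ (π.to a)) ≈ a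
    fix′ a a∈A = 𝔸.trans
      (π.from-cong (fix (π.to a) (FinSubset.respects A (𝔸.sym (π.from∘to a)) a∈A)))
      (π.from∘to a)

  finitelySupportedPart : PermSet x e → NominalSet (lsuc (c ⊔ ℓ) ⊔ x ⊔ e) e
  finitelySupportedPart X = record
    { permSet = record
      { setoid     = subsetoid X.setoid (FinitelySupported X)
      ; _·_        = λ π (u , A , supp) → π X.· u , image π A , image-supports X π A supp
      ; ·-cong     = X.·-cong
      ; ·-identity = λ (u , _) → X.·-identity u
      ; ·-assoc    = λ π σ (u , _) → X.·-assoc π σ u
      }
    ; finitely-supported = λ (u , A , supp) → A , supp
    }
    where module X = GSet X

  infixr 8 _^ᴺ_
  _^ᴺ_ : NominalSet y f → NominalSet x e →
         NominalSet (lsuc (c ⊔ ℓ) ⊔ x ⊔ e ⊔ y ⊔ f) (x ⊔ f)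
  Y ^ᴺ X = finitelySupportedPart (NominalSet.permSet X ⇒ᴳ NominalSet.permSet Y)

  1ᴺ : NominalSet 0ℓ 0ℓ
  1ᴺ = discrete (≡.setoid ⊤)

  ℕᴺ : NominalSet 0ℓ 0ℓ
  ℕᴺ = discrete (≡.setoid ℕ)

{-# OPTIONS --safe #-}

-- Let S be a support function, choose an atom a outside S(f₀) for f₀ the constant
-- function ∗, and for α : ℕ → 2 let f(n) be a where α(n) = 1 and ∗ where α(n) = 0.
-- Membership a ∈ S(f) is decidable.  If a ∈ S(f), then α is not identically 0, as
-- otherwise f = f₀ and a ∈ S(f₀).  If a ∉ S(f), then transposing a with a fresh atom
-- leaves f unchanged, so a is not a value of f and α is identically 0.

module Submission where

open import Defs
open import Data.Fin.Base using (Fin; zero; suc)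
open import Data.List.Base using ([]; _∷_; [_])
open import Data.List.Relation.Unary.Any as Any using (here; there)
open import Data.Nat.Base using (ℕ)
open import Data.Product.Base using (_,_; _×_; ∃; proj₁; proj₂)
open import Data.Sum.Base using (_⊎_; inj₁; inj₂)
open import Data.Sum.Relation.Binary.Pointwise using (inj₁; inj₂)
open import Data.Unit.Base using (⊤; tt)
open import Function.Base using (_∘_)
open import Function.Bundles using (Func; Inverse; _⟨$⟩_)
open import Relation.Binary.Bundles using (DecSetoid)
open import Relation.Binary.PropositionalEquality as ≡ using (_≡_)
open import Relation.Nullary using (Dec; yes; no; contradiction)
open import Relation.Nullary.Decidable using (map′)
import Data.List.Membership.Setoid as Membership
import Data.List.Membership.Setoid.Properties as Membershipₚ

module _ {c ℓ} (𝔸 : DecSetoid c ℓ) where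
  open DecSetoid 𝔸 using (_≈_; _≉_; _≟_; refl; sym; trans) renaming (Carrier to Atom; setoid to 𝔸ₛ)
  open Nominal 𝔸

  elements⊆ : (A : FinSubset 𝔸ₛ) → ∀ {a} →
              Membership._∈_ 𝔸ₛ a (elements 𝔸ₛ (FinSubset.finite A)) → a ∈ A
  elements⊆ A a∈xs with Membershipₚ.∈-tabulate⁻ 𝔸ₛ a∈xs
  ... | i , a≈aᵢ = FinSubset.respects A (sym a≈aᵢ)
                     (proj₂ (Inverse.to (proj₂ (FinSubset.finite A)) i))

  -- `member` may be any predicate, but the bijection with some `Fin n` lists the elements, and
  -- decidable equality of atoms allows a search through that list.
  _∈?_ : ∀ a (A : FinSubset 𝔸ₛ) → Dec (a ∈ A)
  a ∈? A = map′ (elements⊆ A) (∈-elements 𝔸ₛ (FinSubset.finite A))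
                (Any.any? (a ≟_) (elements 𝔸ₛ (FinSubset.finite A)))

  fresh : Infinite 𝔸ₛ → ∀ a (A : FinSubset 𝔸ₛ) → ∃ λ b → b ≉ a × b ∉ A
  fresh infinite a A
    -- Adjoining `a` to a listing of `A` gives one finite subset; avoiding it yields both conditions
    -- on `b`.
    with b , b∉ ← infinite (fromList 𝔸 (a ∷ elements 𝔸ₛ (FinSubset.finite A)))
    = b , b∉ ∘ here , b∉ ∘ there ∘ ∈-elements 𝔸ₛ (FinSubset.finite A)

  module _ (a b : Atom) where

    swap : Atom → Atom
    swap x with x ≟ a | x ≟ b
    ... | yes _ | _     = b
    ... | no  _ | yes _ = a
    ... | no  _ | no  _ = x

    swap-≈ˡ : ∀ {x} → x ≈ a → swap x ≈ b
    swap-≈ˡ {x} x≈a with x ≟ a | x ≟ b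
    ... | yes _   | _ = refl
    ... | no  x≉a | _ = contradiction x≈a x≉a

    swap-≈ʳ : ∀ {x} → x ≈ b → swap x ≈ a
    swap-≈ʳ {x} x≈b with x ≟ a | x ≟ b
    -- `swap` tests for `a` first, so its value here is `b`; this agrees with `a` because `x` equals
    -- both.
    ... | yes x≈a | _       = trans (sym x≈b) x≈a
    ... | no  _   | yes _   = refl
    ... | no  _   | no  x≉b = contradiction x≈b x≉b

    swap-≉ : ∀ {x} → x ≉ a → x ≉ b → swap x ≈ x
    swap-≉ {x} x≉a x≉b with x ≟ a | x ≟ b
    ... | yes x≈a | _       = contradiction x≈a x≉a
    ... | no  _   | yes x≈b = contradiction x≈b x≉b
    ... | no  _   | no  _   = refl

    swap-cong : ∀ {x y} → x ≈ y → swap x ≈ swap y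
    swap-cong {x} {y} x≈y with x ≟ a | x ≟ b
    -- Only `x` has been tested, so `swap y` is evaluated by carrying the outcome along `x≈y`.
    ... | yes x≈a | _       = sym (swap-≈ˡ (trans (sym x≈y) x≈a))
    ... | no  _   | yes x≈b = sym (swap-≈ʳ (trans (sym x≈y) x≈b))
    ... | no  x≉a | no  x≉b =
      trans x≈y (sym (swap-≉ (x≉a ∘ trans x≈y) (x≉b ∘ trans x≈y)))

    swap-involutive : ∀ x → swap (swap x) ≈ x
    swap-involutive x with x ≟ a | x ≟ b
    ... | yes x≈a | _       = trans (swap-≈ʳ refl) (sym x≈a)
    ... | no  _   | yes x≈b = trans (swap-≈ˡ refl) (sym x≈b)
    ... | no  x≉a | no  x≉b = swap-≉ x≉a x≉b

    transposition : FinPerm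
    transposition = mkFinPerm
      (record
        { to        = swap
        ; from      = swap
        ; to-cong   = swap-cong
        ; from-cong = swap-cong
        ; inverse   = (λ eq → trans (swap-cong eq) (swap-involutive _))
                    , (λ eq → trans (swap-cong eq) (swap-involutive _))
        })
      (a ∷ b ∷ []) moved
      where
      moved : ∀ {x} → swap x ≉ x → Membership._∈_ 𝔸ₛ x (a ∷ b ∷ [])
      moved {x} swap≉ with x ≟ a | x ≟ b
      ... | yes x≈a | _       = here x≈a
      ... | no  _   | yes x≈b = there (here x≈b)
      ... | no  _   | no  _   = contradiction refl swap≉

  Seq : NominalSet _ _
  Seq = (atoms ⊎ᴺ 1ᴺ) ^ᴺ ℕᴺ

  ∗-seq : NominalSet.Carrier Seq
  ∗-seq = record { to = λ _ → inj₂ tt ; cong = λ _ → inj₂ ≡.refl }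
        , fromList 𝔸 [] , λ _ _ _ → inj₂ ≡.refl

  module _ (a : Atom) where

    atom-if : Fin 2 → Atom ⊎ ⊤
    atom-if zero    = inj₂ tt
    atom-if (suc _) = inj₁ a

    -- The singleton of `a` is a support whether or not the value `a` occurs, so this element of
    -- `Seq` is available before anything is decided about `α`.
    indicator : (ℕ → Fin 2) → NominalSet.Carrier Seq
    indicator α =
        record { to = atom-if ∘ α ; cong = λ { ≡.refl → GSet.refl A+1 } }
      , fromList 𝔸 [ a ] , λ π fix n → fixed π (fix a (here refl)) (α n)
      where
      A+1 = NominalSet.permSet (atoms ⊎ᴺ 1ᴺ)
      open GSet A+1 using (_·_) renaming (_≈_ to _≈₊_)
      fixed : ∀ π → FinPerm.to π a ≈ a → ∀ i → π · atom-if i ≈₊ atom-if i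
      fixed π πa≈a zero    = inj₂ ≡.refl
      fixed π πa≈a (suc _) = inj₁ πa≈a

    -- Equality in `Seq` compares functions pointwise and ignores the attached supports, here
    -- `[ a ]` against `[]`.
    indicator-zero : ∀ α → (∀ n → α n ≡ zero) → NominalSet._≈_ Seq (indicator α) ∗-seq
    indicator-zero α α≡0 n rewrite α≡0 n = inj₂ ≡.refl

    unsupported⇒zero : Infinite 𝔸ₛ → ∀ α (A : FinSubset 𝔸ₛ) →
                       IsSupport (NominalSet.permSet Seq) (_∈ A) (indicator α) →
                       a ∉ A → ∀ n → α n ≡ zero
    unsupported⇒zero infinite α A supp a∉A n
      with b , b≉a , b∉A ← fresh infinite a A
      -- `ℕᴺ` carries the trivial action, so at index `n` the support condition says that the
      -- transposition fixes the value selected by `α n`.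
      with α n | supp (transposition a b) fixes n
      where
      fixes : ∀ x → x ∈ A → swap a b x ≈ x
      fixes x x∈A = swap-≉ a b (λ x≈a → a∉A (FinSubset.respects A x≈a x∈A))
                               (λ x≈b → b∉A (FinSubset.respects A x≈b x∈A))
    ... | zero  | _              = ≡.refl
    ... | suc _ | inj₁ swap-a≈a =
      contradiction (trans (sym (swap-≈ˡ a b refl)) swap-a≈a) b≉a

theorem2 : ∀ {c ℓ} (𝔸 : DecSetoid c ℓ) → Infinite (DecSetoid.setoid 𝔸) →
    let open Nominal 𝔸 in SupportFunction ((atoms ⊎ᴺ 1ᴺ) ^ᴺ ℕᴺ) → WLPO
theorem2 𝔸 infinite (S , supports) α
  with a , a∉S∗ ← infinite (S ⟨$⟩ ∗-seq 𝔸)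
  with _∈?_ 𝔸 a (S ⟨$⟩ indicator 𝔸 a α)
... | yes a∈Sf = inj₂ λ α≡0 →
  -- Extensionality of `S` enters here: equal sequences get supports with the same members, and
  -- `proj₁` is the inclusion into the support that avoids `a`.
  a∉S∗ (proj₁ (Func.cong S {indicator 𝔸 a α} {∗-seq 𝔸} (indicator-zero 𝔸 a α α≡0)) a∈Sf)
... | no  a∉Sf = inj₁
  (unsupported⇒zero 𝔸 a infinite α (S ⟨$⟩ indicator 𝔸 a α) (supports (indicator 𝔸 a α)) a∉Sf)
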